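{- Let $k$ be a positive integer. For integers $q\ge 2$ let \[ G_k(q) = \min \{ |kA| : A\subset \mathbb{Z} \text{ finite},\ A-A \supset \{a+1, \ldots, a+q \} \text{ for some integer } a \}, \] and put $\alpha_k = \inf_{q\geq 2} \frac{\log G_k(q)}{\log q}$. Then \[ 1-2^{ -k} \leq \alpha_k < 1 . \]
   Context: For a set $A$ of integers, $kA = A+\cdots+A$ ($k$ times) is the set of all sums of $k$ (not necessarily distinct) elements of $A$, and $A-A=\{a-b: a,b\in A\}$. -}

module Defs where

open import Data.Nat using (ℕ; zero; suc; _≤_)
open import Data.Integer using (ℤ; +_; _+_; _-_; _≟_)
open import Data.List using (List; []; _∷_; [_]; map; concatMap; length; deduplicate)
open import Data.List.Membership.Propositional using (_∈_)
open import Data.Product using (∃; ∃-syntax; _×_)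
open import Relation.Binary.PropositionalEquality using (_≡_)

-- A finite set of integers is represented by a list (duplicates irrelevant).
-- sumsetList k A lists all sums of k (not necessarily distinct) elements of A.
sumsetList : ℕ → List ℤ → List ℤ
sumsetList zero    A = [ + 0 ]
sumsetList (suc k) A = concatMap (λ s → map (λ x → s + x) A) (sumsetList k A)

card : List ℤ → ℕ
card L = length (deduplicate _≟_ L)

kSumCard : ℕ → List ℤ → ℕ
kSumCard k A = card (sumsetList k A)

DiffCovers : List ℤ → ℤ → ℕ → Set
DiffCovers A a q = ∀ (i : ℕ) → 1 ≤ i → i ≤ q →
  ∃[ x ] ∃[ y ] (x ∈ A × y ∈ A × x - y ≡ a + + i)

{-# OPTIONS --safe #-}
module Submission where

-- Lower bound: if x i - y i = a + i for x i, y i ∈ A, then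
-- (i , s) ↦ (s + x i , s + y i) is injective, so q |kA| ≤ |(k+1)A|², and one inducts on k.
--
-- Upper bound (after Haight and Ruzsa): take A = {x d} ∪ {x d + d} for
-- 1 ≤ d ≤ M, with x d read modulo M.  Such an A covers all differences d, and
-- kA lies in [0 , 2kM]; so |kA| < M follows once every k-fold sum
-- ∑ (x d + b d), b ∈ {0 , 1}, is divisible by one of several pairwise coprime
-- divisors m of M with ∑ 1/m < 1/(2k+1).  If x d ≡ - (n/a) d modulo m, then
-- a summands sharing the same d modulo m, exactly n of them with b = 1, add up
-- to 0 modulo m.  The ratio n/a is prescribed by a word of length k over the
-- residues modulo an earlier modulus N | M, one fresh m for each word, so that
-- a sum is killed as soon as its summands agreeing modulo N also agree
-- modulo m.  Starting from one class, k rounds of such extensions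
-- N = M₀ | M₁ | ... suffice, since k summands cannot split k times.

open import Defs
open import Data.Nat using (ℕ; zero; suc; pred; _+_; _*_; _^_; _∸_; _!; _≤_; _<_; z≤n; s≤s; _≟_; NonZero)
open import Data.Nat.Properties
open import Data.Nat.DivMod using (_/_; _%_; %-distribˡ-+; %-distribˡ-*; m%n<n; m%n≤n; m∣n⇒o%n%m≡o%m; [m+kn]%n≡m%n; m*[n/m]≡n)
open import Data.Nat.Divisibility using (_∣_; divides; ∣-refl; ∣-trans; m∣m*n; n∣m*n; ∣m∣n⇒∣m+n; m≤n⇒m!∣n!; m%n≡0⇒n∣m; n∣m⇒m%n≡0)
open import Data.Nat.Tactic.RingSolver using (solve-∀)
open import Data.Integer using (ℤ)
import Data.Integer as ℤ
import Data.Integer.Properties as ℤ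
open import Data.Integer.Tactic.RingSolver using () renaming (solve-∀ to ℤ-solve-∀)
open import Algebra.Properties.AbelianGroup ℤ.+-0-abelianGroup using (∙-cancelˡ; ∙-cancelʳ)
open import Data.Fin using (Fin; toℕ)
open import Data.Fin.Properties using (toℕ-injective; toℕ<n)
open import Data.List using (List; []; _∷_; _++_; map; length; foldr; upTo; allFin; concatMap; cartesianProduct; cartesianProductWith; deduplicate)
open import Data.List.Properties using (length-map; length-++; length-upTo; length-tabulate)
open import Data.List.Membership.Propositional using (_∈_; find; lose)
open import Data.List.Membership.Propositional.Properties
open import Data.List.Relation.Binary.Subset.Propositional using (_⊆_)
open import Data.List.Relation.Unary.All as All using (All; []; _∷_)
import Data.List.Relation.Unary.All.Properties as All
open import Data.List.Relation.Unary.Any as Any using (Any; here; there; any?)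
open import Data.List.Relation.Unary.Unique.Propositional using (Unique; []; _∷_)
open import Data.List.Relation.Unary.Unique.Propositional.Properties using (map⁺; allFin⁺; cartesianProduct⁺)
open import Data.List.Relation.Unary.Unique.DecPropositional.Properties ℤ._≟_ using (deduplicate-!)
open import Data.Product using (∃-syntax; _×_; _,_; proj₁; proj₂)
open import Data.Sum using (_⊎_; inj₁; inj₂)
open import Function using (_∘_; id)
open import Function.Definitions using (Injective)
open import Relation.Nullary using (yes; no; contradiction)
open import Relation.Binary.PropositionalEquality

-- Counting distinct elements of lists.

length-cartesianProduct : ∀ {a b} {X : Set a} {Y : Set b} (xs : List X) (ys : List Y) →
  length (cartesianProduct xs ys) ≡ length xs * length ys
length-cartesianProduct []       ys = refl
length-cartesianProduct (x ∷ xs) ys = trans (length-++ (map (x ,_) ys))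
  (cong₂ _+_ (length-map (x ,_) ys) (length-cartesianProduct xs ys))

^-distribʳ-* : ∀ n x y → (x * y) ^ n ≡ x ^ n * y ^ n
^-distribʳ-* zero    x y = refl
^-distribʳ-* (suc n) x y =
  trans (cong (x * y *_) (^-distribʳ-* n x y)) ([m*n]*[o*p]≡[m*o]*[n*p] x y (x ^ n) (y ^ n))

-- Pigeonhole by deletion: one occurrence of the head `x` is cut out of `ys`; the tail avoids `x`,
-- so it still lies in what remains.
unique-⊆⇒length≤ : ∀ {a} {X : Set a} {xs ys : List X} → Unique xs → xs ⊆ ys → length xs ≤ length ys
unique-⊆⇒length≤ [] _ = z≤n
unique-⊆⇒length≤ {xs = x ∷ xs} (x∉xs ∷ xs!) xs⊆ys
  with us , vs , refl ← ∈-∃++ (xs⊆ys (here refl)) = begin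
    suc (length xs)             ≤⟨ s≤s (unique-⊆⇒length≤ xs! λ z∈xs → avoid (All.lookup x∉xs z∈xs) (xs⊆ys (there z∈xs))) ⟩
    suc (length (us ++ vs))     ≡⟨ cong suc (length-++ us) ⟩
    suc (length us + length vs) ≡⟨ +-suc _ _ ⟨
    length us + suc (length vs) ≡⟨ length-++ us ⟨
    length (us ++ x ∷ vs)       ∎
  where
  open ≤-Reasoning
  avoid : ∀ {z} → x ≢ z → z ∈ us ++ x ∷ vs → z ∈ us ++ vs
  avoid x≢z z∈ with ∈-++⁻ us z∈
  ... | inj₁ z∈us         = ∈-++⁺ˡ z∈us
  ... | inj₂ (here z≡x)   = contradiction (sym z≡x) x≢z
  ... | inj₂ (there z∈vs) = ∈-++⁺ʳ us z∈vs

card-⊆ : ∀ {L L′} → L ⊆ L′ → card L ≤ length L′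
card-⊆ {L} L⊆L′ = unique-⊆⇒length≤ (deduplicate-! L) (L⊆L′ ∘ ∈-deduplicate⁻ ℤ._≟_ L)

-- The lower bound.

∈-sumsetList-suc⁺ : ∀ k {A s x} → s ∈ sumsetList k A → x ∈ A → s ℤ.+ x ∈ sumsetList (suc k) A
∈-sumsetList-suc⁺ k {A} {s} s∈ x∈ =
  ∈-concatMap⁺ (λ s → map (λ x → s ℤ.+ x) A) (Any.map (λ { refl → ∈-map⁺ (λ x → s ℤ.+ x) x∈ }) s∈)

-- Ruzsa's injection (i , s) ↦ (s + x i , s + y i): subtracting the two
-- coordinates recovers x i - y i, hence i.
q*kSumCard≤kSumCard-suc² : ∀ q A a → DiffCovers A a q → ∀ k →
  q * kSumCard k A ≤ kSumCard (suc k) A * kSumCard (suc k) A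
q*kSumCard≤kSumCard-suc² q A a covers k = begin
  q * length S                               ≡⟨ cong (_* length S) (length-tabulate {n = q} id) ⟨
  length (allFin q) * length S               ≡⟨ length-cartesianProduct (allFin q) S ⟨
  length domain                              ≡⟨ length-map f domain ⟨
  length (map f domain)                      ≤⟨ unique-⊆⇒length≤ (map⁺ f-injective (cartesianProduct⁺ (allFin⁺ q) (deduplicate-! _))) image⊆ ⟩
  length (cartesianProduct S⁺ S⁺)            ≡⟨ length-cartesianProduct S⁺ S⁺ ⟩
  length S⁺ * length S⁺                      ∎
  where
  open ≤-Reasoning
  S  = deduplicate ℤ._≟_ (sumsetList k A)
  S⁺ = deduplicate ℤ._≟_ (sumsetList (suc k) A)
  domain = cartesianProduct (allFin q) S

  pair : (i : Fin q) → ∃[ x ] ∃[ y ] (x ∈ A × y ∈ A × x ℤ.- y ≡ a ℤ.+ ℤ.+ suc (toℕ i))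
  pair i = covers (suc (toℕ i)) (s≤s z≤n) (toℕ<n i)

  x y : Fin q → ℤ
  x i = proj₁ (pair i)
  y i = proj₁ (proj₂ (pair i))

  f : Fin q × ℤ → ℤ × ℤ
  f (i , s) = s ℤ.+ x i , s ℤ.+ y i

  x∈ : ∀ i → x i ∈ A
  x∈ i = proj₁ (proj₂ (proj₂ (pair i)))
  y∈ : ∀ i → y i ∈ A
  y∈ i = proj₁ (proj₂ (proj₂ (proj₂ (pair i))))

  cancel : ∀ s x y → (s ℤ.+ x) ℤ.- (s ℤ.+ y) ≡ x ℤ.- y
  cancel = ℤ-solve-∀

  difference : ∀ i s → (s ℤ.+ x i) ℤ.- (s ℤ.+ y i) ≡ a ℤ.+ ℤ.+ suc (toℕ i)
  difference i s = trans (cancel s (x i) (y i)) (proj₂ (proj₂ (proj₂ (proj₂ (pair i)))))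

  f-injective : Injective _≡_ _≡_ f
  f-injective {i , s} {j , t} fi≡fj with toℕ-injective (suc-injective (ℤ.+-injective (∙-cancelˡ a _ _
      (trans (sym (difference i s)) (trans (cong₂ ℤ._-_ (cong proj₁ fi≡fj) (cong proj₂ fi≡fj)) (difference j t))))))
  ... | refl = cong (i ,_) (∙-cancelʳ (x i) s t (cong proj₁ fi≡fj))

  image⊆ : map f domain ⊆ cartesianProduct S⁺ S⁺
  image⊆ v∈ with (i , s) , is∈ , refl ← ∈-map⁻ f v∈
    with _ , s∈ ← ∈-cartesianProduct⁻ (allFin q) S is∈ =
      ∈-cartesianProduct⁺ (in-S⁺ (x∈ i)) (in-S⁺ (y∈ i))
    where
    in-S⁺ : ∀ {z} → z ∈ A → s ℤ.+ z ∈ S⁺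
    in-S⁺ z∈ = ∈-deduplicate⁺ ℤ._≟_ (∈-sumsetList-suc⁺ k (∈-deduplicate⁻ ℤ._≟_ (sumsetList k A) s∈) z∈)

-- With `n = 2 ^ k`, the inequality `q * s ≤ t * t` is raised to the power `n`, and the induction
-- hypothesis bounds `s ^ n` below by `q ^ (n ∸ 1)`. For `k = 0` both sides are 1.
kSumCard-lower : ∀ q A a → DiffCovers A a q → ∀ k → q ^ (2 ^ k ∸ 1) ≤ kSumCard k A ^ (2 ^ k)
kSumCard-lower q A a covers zero    = ≤-refl
kSumCard-lower q A a covers (suc k) = begin
  q ^ (2 * n ∸ 1)           ≡⟨ cong (λ r → q ^ (n + r ∸ 1)) (+-identityʳ n) ⟩
  q ^ (n + n ∸ 1)           ≡⟨ cong (q ^_) (+-∸-assoc n (m^n>0 2 k)) ⟩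
  q ^ (n + (n ∸ 1))         ≡⟨ ^-distribˡ-+-* q n (n ∸ 1) ⟩
  q ^ n * q ^ (n ∸ 1)       ≤⟨ *-monoʳ-≤ (q ^ n) (kSumCard-lower q A a covers k) ⟩
  q ^ n * s ^ n             ≡⟨ ^-distribʳ-* n q s ⟨
  (q * s) ^ n               ≤⟨ ^-monoˡ-≤ n (q*kSumCard≤kSumCard-suc² q A a covers k) ⟩
  (t * t) ^ n               ≡⟨ ^-distribʳ-* n t t ⟩
  t ^ n * t ^ n             ≡⟨ ^-distribˡ-+-* t n n ⟨
  t ^ (n + n)               ≡⟨ cong (λ r → t ^ (n + r)) (+-identityʳ n) ⟨
  t ^ (2 * n)               ∎
  where
  open ≤-Reasoning
  n = 2 ^ k
  s = kSumCard k A
  t = kSumCard (suc k) A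

-- Finite sums and congruences.

private variable
  X Y : Set

-- (d , b) stands for the summand x d + b d; after reduction, d is a residue.
Item : Set
Item = ℕ × ℕ

∑ : (X → ℕ) → List X → ℕ
∑ f []       = 0
∑ f (x ∷ xs) = f x + ∑ f xs

∑-cong : ∀ {f g : X → ℕ} xs → (∀ {x} → x ∈ xs → f x ≡ g x) → ∑ f xs ≡ ∑ g xs
∑-cong []       f≡g = refl
∑-cong (x ∷ xs) f≡g = cong₂ _+_ (f≡g (here refl)) (∑-cong xs (f≡g ∘ there))

∑-+ : ∀ (f g : X → ℕ) xs → ∑ (λ x → f x + g x) xs ≡ ∑ f xs + ∑ g xs
∑-+ f g []       = refl
∑-+ f g (x ∷ xs) = trans (cong (_ +_) (∑-+ f g xs)) (interchange (f x) (g x) (∑ f xs) (∑ g xs))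
  where
  interchange : ∀ a b c d → a + b + (c + d) ≡ a + c + (b + d)
  interchange = solve-∀

∑-*ˡ : ∀ c (f : X → ℕ) xs → ∑ (λ x → c * f x) xs ≡ c * ∑ f xs
∑-*ˡ c f []       = sym (*-zeroʳ c)
∑-*ˡ c f (x ∷ xs) = trans (cong (_ +_) (∑-*ˡ c f xs)) (sym (*-distribˡ-+ c (f x) (∑ f xs)))

∑-*ʳ : ∀ c (f : X → ℕ) xs → ∑ (λ x → f x * c) xs ≡ ∑ f xs * c
∑-*ʳ c f []       = refl
∑-*ʳ c f (x ∷ xs) = trans (cong (_ +_) (∑-*ʳ c f xs)) (sym (*-distribʳ-+ c (f x) (∑ f xs)))

∑-map : ∀ (f : Y → ℕ) (h : X → Y) xs → ∑ f (map h xs) ≡ ∑ (f ∘ h) xs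
∑-map f h []       = refl
∑-map f h (x ∷ xs) = cong (_ +_) (∑-map f h xs)

∑-swap : ∀ (f : X → Y → ℕ) xs ys → ∑ (λ x → ∑ (f x) ys) xs ≡ ∑ (λ y → ∑ (λ x → f x y) xs) ys
∑-swap f []       ys = sym (∑-*ˡ 0 (λ _ → 0) ys)
∑-swap f (x ∷ xs) ys = trans (cong (_ +_) (∑-swap f xs ys)) (sym (∑-+ (f x) _ ys))

∑-≤ : ∀ (f : X → ℕ) c xs → (∀ {x} → x ∈ xs → f x ≤ c) → ∑ f xs ≤ length xs * c
∑-≤ f c []       f≤c = z≤n
∑-≤ f c (x ∷ xs) f≤c = +-mono-≤ (f≤c (here refl)) (∑-≤ f c xs (f≤c ∘ there))

+-cong-% : ∀ m .{{_ : NonZero m}} x x′ y y′ → x % m ≡ x′ % m → y % m ≡ y′ % m → (x + y) % m ≡ (x′ + y′) % m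
+-cong-% m x x′ y y′ x≡ y≡ = begin
  (x + y) % m              ≡⟨ %-distribˡ-+ x y m ⟩
  (x % m + y % m) % m      ≡⟨ cong₂ (λ r s → (r + s) % m) x≡ y≡ ⟩
  (x′ % m + y′ % m) % m    ≡⟨ %-distribˡ-+ x′ y′ m ⟨
  (x′ + y′) % m            ∎
  where open ≡-Reasoning

*-congˡ-% : ∀ m .{{_ : NonZero m}} c x x′ → x % m ≡ x′ % m → (c * x) % m ≡ (c * x′) % m
*-congˡ-% m c x x′ x≡ = begin
  (c * x) % m              ≡⟨ %-distribˡ-* c x m ⟩
  (c % m * (x % m)) % m    ≡⟨ cong (λ r → (c % m * r) % m) x≡ ⟩
  (c % m * (x′ % m)) % m   ≡⟨ %-distribˡ-* c x′ m ⟨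
  (c * x′) % m             ∎
  where open ≡-Reasoning

∑-cong-% : ∀ m .{{_ : NonZero m}} {f g : X → ℕ} xs → (∀ {x} → x ∈ xs → f x % m ≡ g x % m) → ∑ f xs % m ≡ ∑ g xs % m
∑-cong-% m []       f≡g = refl
∑-cong-% m (x ∷ xs) f≡g = +-cong-% m _ _ _ _ (f≡g (here refl)) (∑-cong-% m xs (f≡g ∘ there))

%-∣-cong : ∀ {m n} .{{_ : NonZero m}} .{{_ : NonZero n}} x y → m ∣ n → x % n ≡ y % n → x % m ≡ y % m
%-∣-cong {m} {n} x y m∣n x≡y =
  trans (sym (m∣n⇒o%n%m≡o%m m n x m∣n)) (trans (cong (_% m) x≡y) (m∣n⇒o%n%m≡o%m m n y m∣n))

-- Cancellation within residue classes.

δ : ℕ → ℕ → ℕ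
δ x y with x ≟ y
... | yes _ = 1
... | no  _ = 0

δ-refl : ∀ x → δ x x ≡ 1
δ-refl x with x ≟ x
... | yes _   = refl
... | no  x≢x = contradiction refl x≢x

δ-sym : ∀ x y → δ x y ≡ δ y x
δ-sym x y with x ≟ y | y ≟ x
... | yes _   | yes _   = refl
... | no  _   | no  _   = refl
... | yes x≡y | no  y≢x = contradiction (sym x≡y) y≢x
... | no  x≢y | yes y≡x = contradiction (sym y≡x) x≢y

δ-cong-% : ∀ m .{{_ : NonZero m}} x y {r s} → (x ≡ y → r % m ≡ s % m) → (δ x y * r) % m ≡ (δ x y * s) % m
δ-cong-% m x y {r} {s} r≡s with x ≟ y
... | yes x≡y = *-congˡ-% m 1 r s (r≡s x≡y)
... | no  _   = refl

-- Denominator and numerator of the ratio `n/a` that the word `w` prescribes on the class `r`; when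
-- every `b` is a bit, `weight` counts the items of the class with `b` equal to 1.
count weight : List Item → ℕ → ℕ
count  w r = ∑ (λ (s , _) → δ r s) w
weight w r = ∑ (λ (s , b) → δ r s * b) w

count≤length : ∀ w r → count w r ≤ length w
count≤length w r = ≤-trans (∑-≤ _ 1 w λ {(s , _)} _ → δ≤1 s) (≤-reflexive (*-identityʳ _))
  where
  δ≤1 : ∀ s → δ r s ≤ 1
  δ≤1 s with r ≟ s
  ... | yes _ = s≤s z≤n
  ... | no  _ = z≤n

count≥1 : ∀ {w r b} → (r , b) ∈ w → 1 ≤ count w r
count≥1 {_} {r} (here refl) = ≤-trans (≤-reflexive (sym (δ-refl r))) (m≤m+n _ _)
count≥1 (there r∈) = ≤-trans (count≥1 r∈) (m≤n+m _ _)

residues : ∀ N .{{_ : NonZero N}} → List Item → List Item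
residues N = map (λ (d , b) → d % N , b)

-- The reason for choosing `K = k !`: every class size from 1 to `k` divides `K`, hence is
-- invertible modulo `1 + K u`.
n∣k! : ∀ {n k} → 1 ≤ n → n ≤ k → n ∣ k !
n∣k! {suc n} _ n≤k = ∣-trans (m∣m*n (n !)) (m≤n⇒m!∣n! n≤k)

suc-pred-≥1 : ∀ {n} → 1 ≤ n → suc (pred n) ≡ n
suc-pred-≥1 {suc n} _ = refl

-- With m = 1 + K u we have K u ≡ -1 (mod m), so coef w K u r represents
-- - weight w r / count w r modulo m whenever count w r divides K
-- (the divisor is suc (pred _) only to be visibly nonzero).
coef : List Item → ℕ → ℕ → ℕ → ℕ
coef w K u r = weight w r * (K / suc (pred (count w r)) * u)

-- In a class of size `c` each coefficient is `- weight / c` modulo `m`, and all `d` of the class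
-- agree modulo `m`, so its `c` offset terms cancel the sum of its `b * d`. To show this, `weight`
-- is expanded as a sum over the class and the order of summation is exchanged.
m∣∑coef : ∀ N .{{_ : NonZero N}} k u W → length W ≤ k →
  (∀ {d b e c} → (d , b) ∈ W → (e , c) ∈ W → d % N ≡ e % N → d % suc (k ! * u) ≡ e % suc (k ! * u)) →
  suc (k ! * u) ∣ ∑ (λ (d , b) → coef (residues N W) (k !) u (d % N) * d + b * d) W
m∣∑coef N k u W len≤k N⇒m = m%n≡0⇒n∣m _ m (begin
  ∑ (λ i → coef w K u (ρ i) * d i + b i * d i) W % m
    ≡⟨ ∑-cong-% m W (λ {i} i∈ → +-cong-% m (coef w K u (ρ i) * d i)
       (∑ (λ j → δ (ρ i) (ρ j) * h j) W) (b i * d i) (b i * d i) (expand i∈) refl) ⟩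
  ∑ (λ i → ∑ (λ j → δ (ρ i) (ρ j) * h j) W + b i * d i) W % m
    -- This step is an exact identity: for fixed `j` the inner sum is `K * u * (b j * d j)`, and one
    -- more copy of `b j * d j` completes the factor `m`.
    ≡⟨ cong (_% m) collapse ⟩
  (m * ∑ (λ i → b i * d i) W) % m
    ≡⟨ n∣m⇒m%n≡0 _ m (m∣m*n (∑ (λ i → b i * d i) W)) ⟩
  0 ∎)
  where
  open ≡-Reasoning
  K = k !
  m = suc (K * u)
  w = residues N W
  d b ρ g h : Item → ℕ
  d (x , _) = x
  b (_ , y) = y
  ρ i = d i % N
  g i = K / suc (pred (count w (ρ i))) * u
  h i = b i * (g i * d i)

  count-∑ : ∀ r → count w r ≡ ∑ (λ i → δ r (ρ i)) W
  count-∑ r = ∑-map _ _ W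

  weight-∑ : ∀ r → weight w r ≡ ∑ (λ i → δ r (ρ i) * b i) W
  weight-∑ r = ∑-map _ _ W

  expand : ∀ {i} → i ∈ W → (coef w K u (ρ i) * d i) % m ≡ ∑ (λ j → δ (ρ i) (ρ j) * h j) W % m
  expand {i} i∈ = begin
    (weight w (ρ i) * g i * d i) % m                      ≡⟨ cong (_% m) (*-assoc (weight w (ρ i)) (g i) (d i)) ⟩
    (weight w (ρ i) * (g i * d i)) % m                    ≡⟨ cong (λ r → (r * (g i * d i)) % m) (weight-∑ (ρ i)) ⟩
    (∑ (λ j → δ (ρ i) (ρ j) * b j) W * (g i * d i)) % m   ≡⟨ cong (_% m) (∑-*ʳ (g i * d i) _ W) ⟨
    ∑ (λ j → δ (ρ i) (ρ j) * b j * (g i * d i)) W % m     ≡⟨ ∑-cong-% m W termwise ⟩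
    ∑ (λ j → δ (ρ i) (ρ j) * h j) W % m                   ∎
    where
    termwise : ∀ {j} → j ∈ W → (δ (ρ i) (ρ j) * b j * (g i * d i)) % m ≡ (δ (ρ i) (ρ j) * h j) % m
    termwise {j} j∈ = trans (cong (_% m) (*-assoc (δ (ρ i) (ρ j)) (b j) (g i * d i)))
      -- Off the class of `i` the factor `δ` vanishes; on it, `N⇒m` allows `d i` to be replaced by
      -- `d j`.
      (δ-cong-% m (ρ i) (ρ j) λ ρi≡ρj → *-congˡ-% m (b j) (g i * d i) (g j * d j)
        (subst (λ r → (g i * d i) % m ≡ (K / suc (pred (count w r)) * u * d j) % m) ρi≡ρj
          (*-congˡ-% m (g i) (d i) (d j) (N⇒m i∈ j∈ ρi≡ρj))))

  count*g : ∀ {j} → j ∈ W → count w (ρ j) * g j ≡ K * u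
  count*g {j} j∈ = begin
    c * (K / suc (pred c) * u)              ≡⟨ *-assoc c _ u ⟨
    c * (K / suc (pred c)) * u              ≡⟨ cong (λ r → r * (K / suc (pred c)) * u) (sym suc-pred-c) ⟩
    suc (pred c) * (K / suc (pred c)) * u   ≡⟨ cong (_* u) (m*[n/m]≡n (subst (_∣ K) (sym suc-pred-c) (n∣k! c≥1 c≤k))) ⟩
    K * u                                   ∎
    where
    c = count w (ρ j)
    c≥1 : 1 ≤ c
    c≥1 = count≥1 (∈-map⁺ (λ (d , b) → d % N , b) j∈)
    c≤k : c ≤ k
    c≤k = ≤-trans (count≤length w (ρ j)) (≤-trans (≤-reflexive (length-map _ W)) len≤k)
    suc-pred-c : suc (pred c) ≡ c
    suc-pred-c = suc-pred-≥1 c≥1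

  pull : ∀ {j} → j ∈ W → ∑ (λ i → δ (ρ i) (ρ j) * h j) W ≡ K * u * (b j * d j)
  pull {j} j∈ = begin
    ∑ (λ i → δ (ρ i) (ρ j) * h j) W   ≡⟨ ∑-*ʳ (h j) _ W ⟩
    ∑ (λ i → δ (ρ i) (ρ j)) W * h j   ≡⟨ cong (_* h j) (∑-cong W λ {i} _ → δ-sym (ρ i) (ρ j)) ⟩
    ∑ (λ i → δ (ρ j) (ρ i)) W * h j   ≡⟨ cong (_* h j) (count-∑ (ρ j)) ⟨
    count w (ρ j) * h j               ≡⟨ shuffle (count w (ρ j)) (b j) (g j) (d j) ⟩
    count w (ρ j) * g j * (b j * d j) ≡⟨ cong (_* (b j * d j)) (count*g j∈) ⟩
    K * u * (b j * d j)               ∎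
    where
    shuffle : ∀ c b g d → c * (b * (g * d)) ≡ c * g * (b * d)
    shuffle = solve-∀

  collapse : ∑ (λ i → ∑ (λ j → δ (ρ i) (ρ j) * h j) W + b i * d i) W ≡ m * ∑ (λ i → b i * d i) W
  collapse = begin
    ∑ (λ i → ∑ (λ j → δ (ρ i) (ρ j) * h j) W + b i * d i) W
      ≡⟨ ∑-+ _ _ W ⟩
    ∑ (λ i → ∑ (λ j → δ (ρ i) (ρ j) * h j) W) W + ∑ (λ i → b i * d i) W
      ≡⟨ cong (_+ ∑ (λ i → b i * d i) W) (∑-swap (λ i j → δ (ρ i) (ρ j) * h j) W W) ⟩
    ∑ (λ j → ∑ (λ i → δ (ρ i) (ρ j) * h j) W) W + ∑ (λ i → b i * d i) W
      ≡⟨ cong (_+ ∑ (λ i → b i * d i) W) (∑-cong W pull) ⟩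
    ∑ (λ j → K * u * (b j * d j)) W + ∑ (λ i → b i * d i) W
      ≡⟨ cong (_+ ∑ (λ i → b i * d i) W) (∑-*ˡ (K * u) _ W) ⟩
    K * u * ∑ (λ i → b i * d i) W + ∑ (λ i → b i * d i) W
      ≡⟨ +-comm (K * u * ∑ (λ i → b i * d i) W) _ ⟩
    m * ∑ (λ i → b i * d i) W ∎

-- Words and stages of the construction.

words : ℕ → List X → List (List X)
words zero    xs = [] ∷ []
words (suc n) xs = cartesianProductWith _∷_ xs (words n xs)

∈-words : ∀ {xs w : List X} → All (_∈ xs) w → w ∈ words (length w) xs
∈-words []           = here refl
∈-words (x∈ ∷ w⊆xs) = ∈-cartesianProductWith⁺ _∷_ x∈ (∈-words w⊆xs)

bits : List ℕ
bits = 0 ∷ 1 ∷ []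

-- With `e = modulus / m`, `sparse` is the condition that the sum of all `1/m` is below `1/T`,
-- cleared of denominators.
record State (T : ℕ) : Set where
  field
    modulus      : ℕ
    offset       : ℕ → ℕ
    -- pairs (m , modulus / m)
    divisors     : List (ℕ × ℕ)
    {{nonZero}}  : NonZero modulus
    2≤modulus    : 2 ≤ modulus
    cofactors    : ∀ {m e} → (m , e) ∈ divisors → m * e ≡ modulus
    sparse       : T * ∑ proj₂ divisors < modulus

  value : Item → ℕ
  value (d , b) = offset d + b * d

  infix 4 _≈_
  _≈_ : ℕ → ℕ → Set
  d ≈ e = d % modulus ≡ e % modulus

  Killed : List Item → Set
  Killed W = ∃[ m ] ∃[ e ] ((m , e) ∈ divisors × m ∣ ∑ value W)

open State hiding (_≈_)

initial : ∀ {T} → State T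
initial {T} = record
  -- Starting from 2 rather than 1 ensures `2 ≤ q` at the end.
  { modulus   = 2
  ; offset    = λ _ → 0
  ; divisors  = []
  ; 2≤modulus = ≤-refl
  ; cofactors = λ ()
  ; sparse    = subst (_< 2) (sym (*-zeroʳ T)) (s≤s z≤n)
  }

-- Extension of stages.

module _ {T : ℕ} where

  -- What keeps a killed sum killed: offsets move only by multiples of the old modulus, hence of
  -- each old divisor. Cofactors may change, since the modulus grows.
  record _⊑_ (S S′ : State T) : Set where
    field
      modulus-∣ : modulus S ∣ modulus S′
      offset-≡  : ∀ d → ∃[ c ] offset S′ d ≡ offset S d + modulus S * c
      divisors-⊆ : ∀ {m e} → (m , e) ∈ divisors S → ∃[ e′ ] (m , e′) ∈ divisors S′
  open _⊑_

  ⊑-refl : ∀ {S} → S ⊑ S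
  ⊑-refl {S} = record
    { modulus-∣  = ∣-refl
    ; offset-≡   = λ d → 0 , sym (trans (cong (offset S d +_) (*-zeroʳ (modulus S))) (+-identityʳ _))
    ; divisors-⊆ = λ {_} {e} m∈ → e , m∈
    }

  ⊑-trans : ∀ {S S′ S″} → S ⊑ S′ → S′ ⊑ S″ → S ⊑ S″
  ⊑-trans {S} {S′} {S″} p q = record
    { modulus-∣  = ∣-trans (modulus-∣ p) (modulus-∣ q)
    ; offset-≡   = offset-≡-trans
    ; divisors-⊆ = λ m∈ → divisors-⊆ q (proj₂ (divisors-⊆ p m∈))
    }
    where
    offset-≡-trans : ∀ d → ∃[ c ] offset S″ d ≡ offset S d + modulus S * c
    offset-≡-trans d with c , eq ← offset-≡ p d | c′ , eq′ ← offset-≡ q d | divides r M′≡rM ← modulus-∣ p =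
      c + r * c′ , (begin
        offset S″ d                                       ≡⟨ eq′ ⟩
        offset S′ d + modulus S′ * c′                     ≡⟨ cong₂ (λ x y → x + y * c′) eq M′≡rM ⟩
        offset S d + modulus S * c + r * modulus S * c′   ≡⟨ regroup (offset S d) (modulus S) c r c′ ⟩
        offset S d + modulus S * (c + r * c′)             ∎)
      where
      open ≡-Reasoning
      regroup : ∀ x M c r c′ → x + M * c + r * M * c′ ≡ x + M * (c + r * c′)
      regroup = solve-∀

  Killed-mono : ∀ {S S′} → S ⊑ S′ → ∀ W → Killed S W → Killed S′ W
  Killed-mono {S} {S′} S⊑S′ W (m , e , m∈ , m∣) with e′ , m∈′ ← divisors-⊆ S⊑S′ m∈ =
    m , e′ , m∈′ , subst (m ∣_) (sym ∑-value) (∣m∣n⇒∣m+n m∣ (∣-trans m∣M (m∣m*n _)))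
    where
    m∣M : m ∣ modulus S
    m∣M = divides e (trans (sym (cofactors S m∈)) (*-comm m e))

    c : Item → ℕ
    c (d , _) = proj₁ (offset-≡ S⊑S′ d)

    value-≡ : ∀ i → value S′ i ≡ value S i + modulus S * c i
    value-≡ (d , b) with c , eq ← offset-≡ S⊑S′ d = trans (cong (_+ b * d) eq) (swapʳ (offset S d) (modulus S * c) (b * d))
      where
      swapʳ : ∀ x y z → x + y + z ≡ x + z + y
      swapʳ = solve-∀

    ∑-value : ∑ (value S′) W ≡ ∑ (value S) W + modulus S * ∑ c W
    ∑-value = trans (∑-cong W (λ {i} _ → value-≡ i))
      (trans (∑-+ _ _ W) (cong (∑ (value S) W +_) (∑-*ˡ (modulus S) c W)))

-- Adjoining fresh moduli, round by round.

module Construction (k : ℕ) where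

  -- Elements of the final set are at most `2 * M`, so a sum of `k` of them is strictly below
  -- `T * M`.
  T : ℕ
  T = suc (2 * k)

  module Step (N : ℕ) .{{_ : NonZero N}} (w : List Item) (S : State T) where
    private
      M = modulus S
      K = k !
      -- The factor `M` gives `fresh ≡ 1` modulo `M`; the factor `T` makes `fresh` exceed `M * T`,
      -- the cost of the new divisor in `newSparse`.
      u = M * T

    fresh : ℕ
    fresh = suc (K * u)

    -- fresh ≡ 1 modulo M, so the factors fresh and (K * u)² represent the
    -- idempotents of the Chinese remainder theorem for the moduli M and fresh.
    newOffset : ℕ → ℕ
    newOffset d = offset S d * fresh + K * u * (K * u) * (coef w K u (d % N) * d)

    newDivisors : List (ℕ × ℕ)
    newDivisors = (fresh , M) ∷ map (λ (m , e) → m , e * fresh) (divisors S)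

    newCofactors : ∀ {m e} → (m , e) ∈ newDivisors → m * e ≡ M * fresh
    newCofactors (here refl) = *-comm fresh M
    newCofactors (there m∈) with (m , e) , m∈′ , refl ← ∈-map⁻ (λ (m , e) → m , e * fresh) m∈ =
      trans (sym (*-assoc m e fresh)) (cong (_* fresh) (cofactors S m∈′))

    newSparse : T * ∑ proj₂ newDivisors < M * fresh
    newSparse = begin-strict
      T * (M + ∑ proj₂ (map (λ (m , e) → m , e * fresh) (divisors S)))
        ≡⟨ cong (λ x → T * (M + x)) (trans (∑-map proj₂ _ (divisors S)) (∑-*ʳ fresh proj₂ (divisors S))) ⟩
      T * (M + E * fresh)          ≡⟨ expand T M E fresh ⟩
      M * T + T * E * fresh        <⟨ +-monoˡ-< (T * E * fresh) (s≤s (m≤n*m u K)) ⟩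
      -- Integrality turns the old strict bound into `T * E + 1 ≤ M`, leaving room for one whole
      -- `fresh`.
      fresh + T * E * fresh        ≤⟨ *-monoˡ-≤ fresh (sparse S) ⟩
      M * fresh                    ∎
      where
      open ≤-Reasoning
      E = ∑ proj₂ (divisors S)
      instance
        K≢0 : NonZero K
        K≢0 = k !≢0
      expand : ∀ T M E f → T * (M + E * f) ≡ M * T + T * E * f
      expand = solve-∀

    next : State T
    next = record
      { modulus   = M * fresh
      ; offset    = newOffset
      ; divisors  = newDivisors
      ; nonZero   = m*n≢0 M fresh
      ; 2≤modulus = ≤-trans (2≤modulus S) (m≤m*n M fresh)
      ; cofactors = newCofactors
      ; sparse    = newSparse
      }

    ⊑-next : S ⊑ next
    ⊑-next = record
      { modulus-∣  = m∣m*n fresh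
      ; offset-≡   = λ d → _ , regroup (offset S d) K M T (coef w K u (d % N) * d)
      ; divisors-⊆ = λ m∈ → _ , there (∈-map⁺ (λ (m , e) → m , e * fresh) m∈)
      }
      where
      regroup : ∀ x K M T c → x * suc (K * (M * T)) + K * (M * T) * (K * (M * T)) * c
                ≡ x + M * (x * K * T + K * T * (K * (M * T)) * c)
      regroup = solve-∀

    newOffset-% : ∀ d → newOffset d % fresh ≡ (coef w K u (d % N) * d) % fresh
    newOffset-% d = begin
      newOffset d % fresh
        -- Adding `c * fresh` replaces a subtraction: with `v = K * u`, `v * v * c + c * (v + 1) = c
        -- + v * c * (v + 1)`, which shows that `v * v` acts as 1.
        ≡⟨ [m+kn]%n≡m%n (newOffset d) c fresh ⟨
      (newOffset d + c * fresh) % fresh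
        ≡⟨ cong (_% fresh) (regroup (offset S d) (K * u) c) ⟩
      (c + (offset S d + K * u * c) * fresh) % fresh
        ≡⟨ [m+kn]%n≡m%n c (offset S d + K * u * c) fresh ⟩
      c % fresh ∎
      where
      open ≡-Reasoning
      c = coef w K u (d % N) * d
      regroup : ∀ x v c → x * suc v + v * v * c + c * suc v ≡ c + (x + v * c) * suc v
      regroup = solve-∀

    Killed-next : ∀ W → residues N W ≡ w → length W ≤ k →
      (∀ {d b e c} → (d , b) ∈ W → (e , c) ∈ W → d % N ≡ e % N → d % fresh ≡ e % fresh) →
      Killed next W
    Killed-next W refl len≤k N⇒fresh = fresh , M , here refl , m%n≡0⇒n∣m _ fresh (begin
      ∑ (value next) W % fresh
        ≡⟨ ∑-cong-% fresh W (λ { {d , b} _ → +-cong-% fresh (newOffset d) (coef w K u (d % N) * d) (b * d) (b * d) (newOffset-% d) refl }) ⟩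
      ∑ (λ (d , b) → coef w K u (d % N) * d + b * d) W % fresh
        ≡⟨ n∣m⇒m%n≡0 _ fresh (m∣∑coef N k u W len≤k N⇒fresh) ⟩
      0 ∎)
      where open ≡-Reasoning

  module _ (N : ℕ) .{{_ : NonZero N}} where
    open Step N using (next; ⊑-next; Killed-next)

    -- `N` stays fixed while the modulus of the state grows, so all words of a round are read modulo
    -- the same number.
    extend : List (List Item) → State T → State T
    extend ws S = foldr next S ws

    ⊑-extend : ∀ ws {S} → S ⊑ extend ws S
    ⊑-extend []       = ⊑-refl
    ⊑-extend (w ∷ ws) = ⊑-trans (⊑-extend ws) (⊑-next w _)

    ≈-next : ∀ w S {d e} → State._≈_ (next w S) d e → State._≈_ S d e
    ≈-next w S {d} {e} = %-∣-cong {{nonZero S}} {{nonZero (next w S)}} d e (_⊑_.modulus-∣ (⊑-next w S))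

    -- The word of `W` has its own fresh modulus, which divides the final modulus; so agreement
    -- modulo the latter suffices, and later extensions preserve the kill.
    Killed-extend : ∀ {W ws} S → residues N W ∈ ws → length W ≤ k →
      (∀ {d b e c} → (d , b) ∈ W → (e , c) ∈ W → d % N ≡ e % N → State._≈_ (extend ws S) d e) →
      Killed (extend ws S) W
    Killed-extend {W} {w ∷ ws} S (here eq) len≤k N⇒M =
      Killed-next w (extend ws S) W eq len≤k λ {d} {_} {e} d∈ e∈ d≡e →
        %-∣-cong {{_}} {{nonZero (next w (extend ws S))}} d e (n∣m*n (modulus (extend ws S))) (N⇒M d∈ e∈ d≡e)
    Killed-extend {W} {w ∷ ws} S (there W∈) len≤k N⇒M =
      Killed-mono (⊑-next w (extend ws S)) W (Killed-extend S W∈ len≤k λ d∈ e∈ d≡e →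
        ≈-next w (extend ws S) (N⇒M d∈ e∈ d≡e))

  alphabet : ℕ → List Item
  alphabet N = cartesianProduct (upTo N) bits

  level : ℕ → State T
  level zero    = initial
  level (suc s) = extend (modulus S) {{nonZero S}} (words k (alphabet (modulus S))) S
    where S = level s

  level-⊑ : ∀ s → level s ⊑ level (suc s)
  level-⊑ s = ⊑-extend (modulus (level s)) {{nonZero (level s)}} (words k (alphabet (modulus (level s))))

  ≈-level : ∀ s {d e} → State._≈_ (level (suc s)) d e → State._≈_ (level s) d e
  ≈-level s {d} {e} = %-∣-cong {{nonZero (level s)}} {{nonZero (level (suc s))}} d e (_⊑_.modulus-∣ (level-⊑ s))

  -- Drives the descent in `Killed-level`: a representative congruent to a later one is dropped, and
  -- if there is none the modulus separates the representatives.
  merge : ∀ (S : State T) (let open State S) (R : List ℕ) →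
    (∃[ R′ ] (length R′ < length R × (∀ {r} → r ∈ R → Any (r ≈_) R′)))
    ⊎ (∀ {r r′} → r ∈ R → r′ ∈ R → r ≈ r′ → r ≡ r′)
  merge S []      = inj₂ λ ()
  merge S (r ∷ R) with any? (λ r′ → r % modulus S ≟ r′ % modulus S) R where instance _ = nonZero S
  ... | yes r≈R = inj₁ (R , ≤-refl , λ { (here refl) → r≈R ; (there r′∈) → lose r′∈ refl })
  ... | no  r≉R with merge S R
  ...   | inj₁ (R′ , R′<R , R≈R′) = inj₁ (r ∷ R′ , s≤s R′<R , λ { (here refl) → here refl ; (there r′∈) → there (R≈R′ r′∈) })
  ...   | inj₂ ≈⇒≡ = inj₂ λ where
          (here refl) (here refl) _   → refl
          (here refl) (there r′∈) r≈  → contradiction (lose r′∈ r≈) r≉R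
          (there r′∈) (here refl) r′≈ → contradiction (lose r′∈ (sym r′≈)) r≉R
          (there r∈)  (there r′∈) r≈  → ≈⇒≡ r∈ r′∈ r≈

  ∈-residue-words : ∀ N .{{_ : NonZero N}} W → length W ≡ k → All (λ (_ , b) → b ∈ bits) W →
    residues N W ∈ words k (alphabet N)
  ∈-residue-words N W len≡k bits∈ = subst (λ n → residues N W ∈ words n (alphabet N))
    (trans (length-map _ W) len≡k)
    (∈-words (All.map⁺ (All.map (λ {(d , _)} b∈ → ∈-cartesianProduct⁺ (∈-upTo⁺ (m%n<n d N)) b∈) bits∈)))

  -- The number of residue classes met by the items of W can grow at most
  -- k - 1 times along the levels; where it does not grow, the fresh moduli of
  -- that level are available.
  Killed-level : 1 ≤ k → ∀ s W → length W ≡ k → All (λ (_ , b) → b ∈ bits) W →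
    ∀ R → length R ≤ s → (∀ {d b} → (d , b) ∈ W → Any (State._≈_ (level s) d) R) → Killed (level s) W
  -- At level 0 there are no representatives, so `W` would be empty, against `1 ≤ k`.
  Killed-level 1≤k zero    []            refl    _     _  _   _     = contradiction 1≤k λ ()
  Killed-level 1≤k zero    ((d , b) ∷ W) _ _ [] _ W≈R with () ← W≈R (here refl)
  Killed-level 1≤k (suc s) W len≡k bits∈ R R≤s W≈R with merge (level s) R
  ... | inj₁ (R′ , R′<R , R≈R′) = Killed-mono (level-⊑ s) W
          (Killed-level 1≤k s W len≡k bits∈ R′ (≤-pred (≤-trans R′<R R≤s)) λ d∈ →
            let r , r∈ , d≈r = find (W≈R d∈) in Any.map (trans (≈-level s d≈r)) (R≈R′ r∈))
  ... | inj₂ ≈⇒≡ = Killed-extend (modulus (level s)) {{nonZero (level s)}} (level s)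
          (∈-residue-words (modulus (level s)) {{nonZero (level s)}} W len≡k bits∈) (≤-reflexive len≡k) refine
    where
    -- Items congruent at level `s` have representatives congruent there, hence equal, so they
    -- already agree at the next level.
    refine : ∀ {d b e c} → (d , b) ∈ W → (e , c) ∈ W → State._≈_ (level s) d e → State._≈_ (level (suc s)) d e
    refine d∈ e∈ d≈e with r , r∈ , d≈r ← find (W≈R d∈) | r′ , r′∈ , e≈r′ ← find (W≈R e∈)
      with refl ← ≈⇒≡ r∈ r′∈ (trans (sym (≈-level s d≈r)) (trans d≈e (≈-level s e≈r′))) =
        trans d≈r (sym e≈r′)

  -- The set with few sums.

  module _ (1≤k : 1 ≤ k) where
    private
      S = level k
      M = modulus S
      instance
        M≢0 : NonZero M
        M≢0 = nonZero S

    -- Reducing the offset modulo `M` bounds the elements without affecting divisibility of sums by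
    -- divisors of `M`.
    element : Item → ℕ
    element (d , b) = offset S d % M + b * d

    items : List Item
    items = cartesianProduct (map suc (upTo M)) bits

    A : List ℤ
    A = map (λ i → ℤ.+ element i) items

    A-covers : DiffCovers A (ℤ.+ 0) M
    A-covers (suc i) _ i<M = ℤ.+ element (suc i , 1) , ℤ.+ element (suc i , 0) , ∈A (there (here refl)) , ∈A (here refl) ,
      difference (ℤ.+ (offset S (suc i) % M)) (ℤ.+ suc i)
      where
      ∈A : ∀ {b} → b ∈ bits → ℤ.+ element (suc i , b) ∈ A
      ∈A b∈ = ∈-map⁺ (λ i → ℤ.+ element i) (∈-cartesianProduct⁺ (∈-map⁺ suc (∈-upTo⁺ i<M)) b∈)

      difference : ∀ x d → (x ℤ.+ (ℤ.+ 1) ℤ.* d) ℤ.- (x ℤ.+ (ℤ.+ 0) ℤ.* d) ≡ ℤ.+ 0 ℤ.+ d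
      difference = ℤ-solve-∀

    ∈-sumset⁻ : ∀ n {y} → y ∈ sumsetList n A → ∃[ W ] (length W ≡ n × All (_∈ items) W × y ≡ ℤ.+ ∑ element W)
    ∈-sumset⁻ zero    (here refl) = [] , refl , [] , refl
    ∈-sumset⁻ (suc n) y∈
      with s , s∈ , y∈′ ← find (∈-concatMap⁻ (λ s → map (λ x → s ℤ.+ x) A) {xs = sumsetList n A} y∈)
      with x , x∈ , refl ← ∈-map⁻ (λ x → s ℤ.+ x) y∈′
      with i , i∈ , refl ← ∈-map⁻ (λ i → ℤ.+ element i) x∈
      with W , len , W⊆ , refl ← ∈-sumset⁻ n s∈ =
        i ∷ W , cong suc len , i∈ ∷ W⊆ , cong ℤ.+_ (+-comm (∑ element W) (element i))

    element≤2M : ∀ {i} → i ∈ items → element i ≤ 2 * M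
    element≤2M {d , b} i∈ with d∈ , b∈ ← ∈-cartesianProduct⁻ (map suc (upTo M)) bits i∈
      with j , j∈ , refl ← ∈-map⁻ suc d∈ =
        +-mono-≤ (m%n≤n (offset S d) M) (*-mono-≤ (bit≤1 b∈) (∈-upTo⁻ j∈))
      where
      bit≤1 : ∀ {b} → b ∈ bits → b ≤ 1
      bit≤1 (here refl)         = z≤n
      bit≤1 (there (here refl)) = ≤-refl

    -- The range `T * e` gives exactly the multiples of `m` below `T * M`, because `m * e` is `M`.
    multiples : List ℤ
    multiples = concatMap (λ (m , e) → map (λ j → ℤ.+ (m * j)) (upTo (T * e))) (divisors S)

    length-multiples : length multiples ≡ T * ∑ proj₂ (divisors S)
    length-multiples = go (divisors S)
      where
      go : ∀ ds → length (concatMap (λ (m , e) → map (λ j → ℤ.+ (m * j)) (upTo (T * e))) ds) ≡ T * ∑ proj₂ ds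
      go []             = sym (*-zeroʳ T)
      go ((m , e) ∷ ds) = begin
        length (map f (upTo (T * e)) ++ _)          ≡⟨ length-++ (map f (upTo (T * e))) ⟩
        length (map f (upTo (T * e))) + length (concatMap _ ds)
          ≡⟨ cong₂ _+_ (trans (length-map f (upTo (T * e))) (length-upTo (T * e))) (go ds) ⟩
        T * e + T * ∑ proj₂ ds                      ≡⟨ *-distribˡ-+ T e _ ⟨
        T * (e + ∑ proj₂ ds)                        ∎
        where
        open ≡-Reasoning
        f : ℕ → ℤ
        f j = ℤ.+ (m * j)

    ∈-multiples : ∀ {m e y} → (m , e) ∈ divisors S → m ∣ y → y < T * M → ℤ.+ y ∈ multiples
    ∈-multiples {m} {e} m∈ (divides j refl) y<TM = ∈-concatMap⁺ _ (lose m∈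
      (subst (λ y → ℤ.+ y ∈ map (λ j → ℤ.+ (m * j)) (upTo (T * e))) (*-comm m j)
        (∈-map⁺ (λ j → ℤ.+ (m * j)) (∈-upTo⁺ (*-cancelʳ-< m j (T * e) (begin-strict
          j * m         <⟨ y<TM ⟩
          T * M         ≡⟨ cong (T *_) (cofactors S m∈) ⟨
          T * (m * e)   ≡⟨ cong (T *_) (*-comm m e) ⟩
          T * (e * m)   ≡⟨ *-assoc T e m ⟨
          T * e * m     ∎))))))
      where open ≤-Reasoning

    sumset⊆multiples : ∀ {y} → y ∈ sumsetList k A → y ∈ multiples
    sumset⊆multiples y∈ with W , len≡k , W⊆ , refl ← ∈-sumset⁻ k y∈
      with m , e , m∈ , m∣ ← Killed-level 1≤k k W len≡k
             (All.map (λ i∈ → proj₂ (∈-cartesianProduct⁻ (map suc (upTo M)) bits i∈)) W⊆)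
             -- Every `d` represents itself; these are `k` representatives, which is why level `k`
             -- suffices.
             (map proj₁ W) (≤-reflexive (trans (length-map proj₁ W) len≡k))
             (λ i∈ → lose (∈-map⁺ proj₁ i∈) refl) =
        ∈-multiples m∈ m∣∑ (begin-strict
          ∑ element W          ≤⟨ ∑-≤ element (2 * M) W (element≤2M ∘ All.lookup W⊆) ⟩
          length W * (2 * M)   ≡⟨ cong (_* (2 * M)) len≡k ⟩
          k * (2 * M)          ≡⟨ shuffle k M ⟩
          2 * k * M            <⟨ m<n+m (2 * k * M) (≤-trans (s≤s z≤n) (2≤modulus S)) ⟩
          T * M                ∎)
      where
      open ≤-Reasoning
      shuffle : ∀ k M → k * (2 * M) ≡ 2 * k * M
      shuffle = solve-∀
      instance
        m≢0 : NonZero m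
        m≢0 = m*n≢0⇒m≢0 m {{subst NonZero (sym (cofactors S m∈)) M≢0}}
      m∣M : m ∣ M
      m∣M = subst (m ∣_) (cofactors S m∈) (m∣m*n e)
      m∣∑ : m ∣ ∑ element W
      m∣∑ = m%n≡0⇒n∣m _ m (trans
        (∑-cong-% m W λ { {d , b} _ → +-cong-% m (offset S d % M) (offset S d) (b * d) (b * d) (m∣n⇒o%n%m≡o%m m M (offset S d) m∣M) refl })
        (n∣m⇒m%n≡0 _ m m∣))

    kSumCard<M : kSumCard k A < M
    kSumCard<M = begin-strict
      kSumCard k A                ≤⟨ card-⊆ sumset⊆multiples ⟩
      length multiples            ≡⟨ length-multiples ⟩
      T * ∑ proj₂ (divisors S)    <⟨ sparse S ⟩
      M                           ∎
      where open ≤-Reasoning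

-- Taking logarithms, the first component is the bound `1 - 2^(-k)` for every `q`. Since `α_k` is an
-- infimum, one `q` with `G_k(q) < q` gives `α_k < 1`.
theorem2 : ∀ (k : ℕ) → 1 ≤ k →
    ((q : ℕ) → 2 ≤ q → (A : List ℤ) → (a : ℤ) → DiffCovers A a q →
    q ^ (2 ^ k ∸ 1) ≤ kSumCard k A ^ (2 ^ k))
    × (∃[ q ] ∃[ A ] ∃[ a ] (2 ≤ q × DiffCovers A a q × kSumCard k A < q))
theorem2 k 1≤k =
  (λ q _ A a covers → kSumCard-lower q A a covers k) ,
  modulus (level k) , A 1≤k , ℤ.+ 0 , 2≤modulus (level k) , A-covers 1≤k , kSumCard<M 1≤k
  where open Construction k
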